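{- For every integer $k\geq 6$, $\operatorname{GM}_{k}(K_{3}:2K_{2})=3$.
   Context: All graphs are finite, simple and undirected; colorings are edge-colorings. $2K_2$ is a matching with $2$ edges. A $k$-coloring is exact if all $k$ colors are used at least once. A colored graph is rainbow if no two of its edges have the same color, and monochromatic if all its edges have the same color. Copies of a graph are counted as (not necessarily induced) subgraphs. The Gallai-Ramsey number $\operatorname{gr}_k(G:H)$ is the minimum integer $m$ with $\binom{m}{2}\geq k$ such that for every $N\geq m$, every exact $k$-coloring of $K_N$ contains a rainbow copy of $G$ or a monochromatic copy of $H$. The Gallai-Ramsey multiplicity $\operatorname{GM}_k(G:H)$ (also written $\operatorname{GM}_k(G,H)$) is the minimum, over all exact $k$-colorings of $K_{\operatorname{gr}_k(G:H)}$, of the total number of rainbow copies of $G$ and monochromatic copies of $H$. -}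

module Defs where

open import Level using (0ℓ)
open import Data.Bool using (Bool; true; false; T; not)
open import Data.Nat using (ℕ; _+_; _≤_)
open import Data.Nat.Combinatorics using (_C_)
open import Data.Fin using (Fin; _≟_)
open import Data.Fin.Patterns using (0F; 1F; 2F; 3F)
open import Data.Fin.Subset using (Subset; _∈_)
open import Data.Product using (Σ; ∃; ∃₂; _×_; _,_; proj₁)
open import Data.Sum using (_⊎_)
open import Function using (Injective; Inverse; _⇔_)
open import Relation.Binary using (Setoid)
import Relation.Binary.Construct.On as On
open import Relation.Binary.PropositionalEquality
  using (_≡_; _≢_; refl; sym; trans; subst; setoid; ≢-sym)
open import Relation.Nullary using (does; yes; no; contradiction)

record Graph (n : ℕ) : Set where
  field
    adj        : Fin n → Fin n → Bool
    adj-sym    : ∀ i j → adj i j ≡ adj j i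
    adj-irrefl : ∀ i → adj i i ≡ false

  Adj : Fin n → Fin n → Set
  Adj i j = T (adj i j)

  Adj⇒≢ : ∀ {i j} → Adj i j → i ≢ j
  Adj⇒≢ {i} e refl = subst T (adj-irrefl i) e

complete : ∀ n → Graph n
complete n = record
  { adj        = λ i j → not (does (i ≟ j))
  ; adj-sym    = symm
  ; adj-irrefl = irr
  }
  where
  symm : ∀ i j → not (does (i ≟ j)) ≡ not (does (j ≟ i))
  symm i j with i ≟ j | j ≟ i
  ... | yes _ | yes _ = refl
  ... | no  _ | no  _ = refl
  ... | yes p | no ¬q = contradiction (sym p) ¬q
  ... | no ¬p | yes q = contradiction (sym q) ¬p

  irr : ∀ i → not (does (i ≟ i)) ≡ false
  irr i with i ≟ i
  ... | yes _ = refl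
  ... | no ¬p = contradiction refl ¬p

K₃ : Graph 3
K₃ = complete 3

2K₂ : Graph 4
2K₂ = record { adj = a ; adj-sym = symm ; adj-irrefl = irr }
  where
  a : Fin 4 → Fin 4 → Bool
  a 0F 1F = true
  a 1F 0F = true
  a 2F 3F = true
  a 3F 2F = true
  a _  _  = false

  symm : ∀ i j → a i j ≡ a j i
  symm 0F 0F = refl
  symm 0F 1F = refl
  symm 0F 2F = refl
  symm 0F 3F = refl
  symm 1F 0F = refl
  symm 1F 1F = refl
  symm 1F 2F = refl
  symm 1F 3F = refl
  symm 2F 0F = refl
  symm 2F 1F = refl
  symm 2F 2F = refl
  symm 2F 3F = refl
  symm 3F 0F = refl
  symm 3F 1F = refl
  symm 3F 2F = refl
  symm 3F 3F = refl

  irr : ∀ i → a i i ≡ false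
  irr 0F = refl
  irr 1F = refl
  irr 2F = refl
  irr 3F = refl

-- A (not necessarily induced) subgraph of the complete graph on Fin N.
-- The vertex set is kept separately so that isolated vertices count; endpoint
-- covers both ends of an edge by symmetry of Adj.
record Subgraph (N : ℕ) : Set where
  field
    vertices : Subset N
    graph    : Graph N
  open Graph graph public
  field
    endpoint : ∀ {i j} → Adj i j → i ∈ vertices

-- Subgraphs are equal when they have the same vertices and the same edges.
subgraphs : ℕ → Setoid 0ℓ 0ℓ
subgraphs N = record
  { Carrier = Subgraph N
  ; _≈_ = λ S S′ → vertices S ≡ vertices S′ × (∀ i j → adj S i j ≡ adj S′ i j)
  ; isEquivalence = record
    { refl  = refl , λ _ _ → refl
    ; sym   = λ (p , q) → sym p , λ i j → sym (q i j)
    ; trans = λ (p , q) (p′ , q′) → trans p p′ , λ i j → trans (q i j) (q′ i j)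
    }
  }
  where open Subgraph

record _≅_ {n N : ℕ} (G : Graph n) (S : Subgraph N) : Set where
  open Subgraph S using (vertices; adj)
  field
    to        : Fin n → Fin N
    injective : Injective _≡_ _≡_ to
    image     : ∀ v → v ∈ vertices ⇔ (∃ λ i → to i ≡ v)
    adj-to    : ∀ i j → adj (to i) (to j) ≡ Graph.adj G i j

-- An edge-coloring of the complete graph on Fin N with color set Fin k.  An
-- edge is an unordered pair of distinct vertices, given here by either of its
-- two orderings; the proof of distinctness is irrelevant.
record Coloring (N k : ℕ) : Set where
  field
    color     : (i j : Fin N) → .(i ≢ j) → Fin k
    color-sym : ∀ i j (i≢j : i ≢ j) → color i j i≢j ≡ color j i (≢-sym i≢j)

module _ {N k : ℕ} (χ : Coloring N k) where
  open Coloring χ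

  Exact : Set
  Exact = ∀ (c : Fin k) → ∃₂ λ i j → Σ (i ≢ j) λ i≢j → color i j i≢j ≡ c

  module _ (S : Subgraph N) where
    open Subgraph S

    Rainbow : Set
    Rainbow = ∀ {i j u v} (e : Adj i j) (f : Adj u v) →
              color i j (Adj⇒≢ e) ≡ color u v (Adj⇒≢ f) →
              (i ≡ u × j ≡ v) ⊎ (i ≡ v × j ≡ u)

    Monochromatic : Set
    Monochromatic = ∀ {i j u v} (e : Adj i j) (f : Adj u v) →
                    color i j (Adj⇒≢ e) ≡ color u v (Adj⇒≢ f)

  RainbowCopy : ∀ {n} → Graph n → Subgraph N → Set
  RainbowCopy G S = G ≅ S × Rainbow S

  MonochromaticCopy : ∀ {n} → Graph n → Subgraph N → Set
  MonochromaticCopy H S = H ≅ S × Monochromatic S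

-- There are exactly c subgraphs satisfying P (up to equality of subgraphs, and
-- regardless of how many proofs of P each one has).
HasCount : ∀ {N} → (Subgraph N → Set) → ℕ → Set
HasCount {N} P c =
  Inverse (setoid (Fin c)) (On.setoid {B = Σ (Subgraph N) P} (subgraphs N) proj₁)

IsMinimum : (ℕ → Set) → ℕ → Set
IsMinimum P m = P m × (∀ n → P n → m ≤ n)

module _ (k : ℕ) {g h : ℕ} (G : Graph g) (H : Graph h) where

  Unavoidable : ℕ → Set
  Unavoidable N = (χ : Coloring N k) → Exact χ →
                  ∃ (RainbowCopy χ G) ⊎ ∃ (MonochromaticCopy χ H)

  -- m = gr_k(G : H)
  IsGallaiRamseyNumber : ℕ → Set
  IsGallaiRamseyNumber =
    IsMinimum λ m → k ≤ m C 2 × (∀ N → m ≤ N → Unavoidable N)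

  -- Some exact k-coloring of K_N has t rainbow copies of G and monochromatic
  -- copies of H in total.
  AttainedTotal : ℕ → ℕ → Set
  AttainedTotal N t =
    ∃ λ (χ : Coloring N k) → Exact χ ×
    ∃₂ λ a b → HasCount (RainbowCopy χ G) a ×
               HasCount (MonochromaticCopy χ H) b ×
               t ≡ a + b

  -- t = GM_k(G : H)
  IsGallaiRamseyMultiplicity : ℕ → Set
  IsGallaiRamseyMultiplicity t =
    ∃ λ m → IsGallaiRamseyNumber m × IsMinimum (AttainedTotal m) t

{-# OPTIONS --safe #-}

-- Every colouring of K_{k+3} with k colours contains a monochromatic 2K₂, even after two edges
-- have been deleted.  More than 3k edges remain, so some colour has four of them; if they
-- pairwise intersect they form a star, and deleting its centre together with its colour leaves
-- the same situation for k - 1.  Deleting one edge of each copy already found gives three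
-- distinct monochromatic 2K₂ in K_{k+3}.  Conversely, on the k + s vertices 0, 1, 2, ... colour
-- ij by max(i,j), with all values up to s identified: there is no rainbow triangle, and a
-- monochromatic 2K₂ must lie in {0,...,s}.  For s = 2 there is none, so gr_k = k + 3; for s = 3
-- there are exactly the three perfect matchings of K₄.

module Submission where

open import Defs
open import Level using (0ℓ)
open import Data.Bool using (Bool; true; false; T; if_then_else_; not; _∨_; _∧_; _xor_)
import Data.Bool as Bool
open import Data.Bool.Properties using (T-≡)
open import Data.Empty using (⊥; ⊥-elim)
open import Data.Nat as ℕ using (ℕ; zero; suc; _+_; _*_; _∸_; _⊔_; _≤_; z≤n; s≤s)
open import Data.Nat.Combinatorics using (_C_; nC1≡n; nCk+nC[k+1]≡[n+1]C[k+1])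
open import Data.Nat.Properties as ℕ using (≤-trans; ≤-reflexive)
open import Data.Fin as Fin using (Fin; zero; suc; _<_; _<?_; _≟_; toℕ; fromℕ<; _↑ʳ_)
open import Data.Fin.Patterns using (0F; 1F; 2F; 3F)
open import Data.Fin.Properties as Fin
  using (any?; all?; <⇒≢; <-asym; injective⇒≤; punchOut-injective)
import Data.Fin.Subset as Subset
open import Data.Fin.Subset.Properties using (⊆-antisym; _∈?_)
open import Data.List using (List; []; _∷_; _++_; map; length; filter; allFin)
open import Data.List.Properties
  using (length-map; length-++; filter-all; filter-notAll; length-tabulate)
open import Data.List.Membership.Propositional using (_∈_)
open import Data.List.Membership.Propositional.Properties
  using (∈-filter⁺; ∈-filter⁻; ∈-map⁻; ∈-++⁻; ∈-allFin)
open import Data.List.Relation.Unary.All as All using (All; []; _∷_)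
open import Data.List.Relation.Unary.AllPairs as AllPairs using (AllPairs; []; _∷_)
import Data.List.Relation.Unary.AllPairs.Properties as AllPairs
open import Data.List.Relation.Unary.Any as Any using (here; there)
open import Data.List.Relation.Unary.Unique.Propositional using (Unique)
import Data.List.Relation.Unary.Unique.Propositional.Properties as Unique
open import Data.Product using (∃; ∃₂; _×_; _,_; proj₁; proj₂)
open import Data.Product.Properties using (≡-dec)
open import Data.Sum using (_⊎_; inj₁; inj₂; [_,_]′)
open import Data.Vec using (Vec; []; _∷_; tabulate; lookup)
open import Data.Vec.Properties using (lookup⇒[]=; []=⇒lookup; lookup∘tabulate)
open import Data.Vec.Relation.Unary.All using ([]; _∷_)
open import Data.Vec.Relation.Unary.Unique.Propositional as Vec using ([]; _∷_)
open import Data.Vec.Relation.Unary.Unique.Propositional.Properties using (lookup-injective)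
open import Function using (_∘_; id; Injective; Inverse; _⇔_; mk⇔; Equivalence)
open import Relation.Binary using (DecidableEquality; Setoid; tri<; tri≈; tri>)
open import Relation.Binary.PropositionalEquality
open import Relation.Nullary using (¬_; Dec; does; yes; no; contradiction)
open import Relation.Nullary.Decidable
  using (¬?; _×-dec_; _⊎-dec_; _→-dec_; T?; ⌊_⌋; toWitness; fromWitness; does-⇔)
open import Relation.Unary using (Pred; Decidable)

-- Counting in lists and the pigeonhole principle

private variable
  A B : Set

length-filter-∁ : {P : Pred A 0ℓ} (P? : Decidable P) (xs : List A) →
                  length xs ≡ length (filter P? xs) + length (filter (¬? ∘ P?) xs)
length-filter-∁ P? []       = refl
length-filter-∁ P? (x ∷ xs) with P? x
... | yes _ = cong suc (length-filter-∁ P? xs)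
... | no  _ = trans (cong suc (length-filter-∁ P? xs)) (sym (ℕ.+-suc _ _))

module _ {A : Set} (_≟ᴬ_ : DecidableEquality A) where

  remove : A → List A → List A
  remove x = filter (λ y → ¬? (y ≟ᴬ x))

  length-remove : ∀ {x xs} → Unique xs → length xs ≤ suc (length (remove x xs))
  length-remove             []            = z≤n
  length-remove {x} {y ∷ _} (y∉ys ∷ uniq) with y ≟ᴬ x
  ... | no  _    = s≤s (length-remove uniq)
  ... | yes refl = s≤s (≤-reflexive (cong length (sym
    (filter-all (λ z → ¬? (z ≟ᴬ x)) (All.map ≢-sym y∉ys)))))

-- Induction on `ys`. Either the fibre over `y` has more than `m` entries, or setting it aside loses
-- at most `m` of them and leaves a list whose values lie in the remaining `ys`.
generalised-pigeonhole :
  (_≟ᴮ_ : DecidableEquality B) (f : A → B) (m : ℕ) (ys : List B) {xs : List A} →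
  Unique xs → (∀ {x} → x ∈ xs → f x ∈ ys) → m * length ys ℕ.< length xs →
  ∃ λ y → y ∈ ys × ∃ λ zs →
    Unique zs × m ℕ.< length zs × (∀ {z} → z ∈ zs → z ∈ xs × f z ≡ y)
generalised-pigeonhole _≟ᴮ_ f m []       {[]}    uniq f∈ lt rewrite ℕ.*-zeroʳ m = contradiction lt λ ()
generalised-pigeonhole _≟ᴮ_ f m []       {_ ∷ _} uniq f∈ lt = contradiction (f∈ (here refl)) λ ()
generalised-pigeonhole _≟ᴮ_ f m (y ∷ ys) {xs}    uniq f∈ lt
  with suc m ℕ.≤? length (filter (λ x → f x ≟ᴮ y) xs)
... | yes large = y , here refl , _ , Unique.filter⁺ _ uniq , large , ∈-filter⁻ _
... | no  small with generalised-pigeonhole _≟ᴮ_ f m ys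
                       (Unique.filter⁺ (λ x → ¬? (f x ≟ᴮ y)) uniq) rest∈ rest-large
  where
  rest∈ : ∀ {x} → x ∈ filter (λ x → ¬? (f x ≟ᴮ y)) xs → f x ∈ ys
  rest∈ x∈ with ∈-filter⁻ _ x∈
  ... | x∈xs , fx≢y with f∈ x∈xs
  ... | here  fx≡y = contradiction fx≡y fx≢y
  ... | there fx∈  = fx∈

  rest-large : m * length ys ℕ.< length (filter (λ x → ¬? (f x ≟ᴮ y)) xs)
  rest-large = ℕ.+-cancelˡ-< m _ _ (begin-strict
    m + m * length ys                                   ≡⟨ ℕ.*-suc m _ ⟨
    m * suc (length ys)                                 <⟨ lt ⟩
    length xs                                           ≡⟨ length-filter-∁ (λ x → f x ≟ᴮ y) xs ⟩
    length (filter (λ x → f x ≟ᴮ y) xs) + length rest   ≤⟨ ℕ.+-monoˡ-≤ _ (ℕ.≮⇒≥ small) ⟩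
    m + length rest                                     ∎)
    where
    open ℕ.≤-Reasoning
    rest : List _
    rest = filter (λ x → ¬? (f x ≟ᴮ y)) xs
... | y′ , y′∈ , zs , uniq′ , large , zs⊆ =
  y′ , there y′∈ , zs , uniq′ , large , λ z∈ → proj₁ (∈-filter⁻ _ (proj₁ (zs⊆ z∈))) , proj₂ (zs⊆ z∈)

-- Edges, incidence and intersecting families

-- An edge is represented by its increasing pair of endpoints.
Edge : ℕ → Set
Edge N = Fin N × Fin N

private variable
  N : ℕ
  x y z : Fin N
  e f g h : Edge N

Increasing : Edge N → Set
Increasing (u , v) = u < v

_≟ᴱ_ : DecidableEquality (Edge N)
_≟ᴱ_ = ≡-dec _≟_ _≟_

_∈ᴱ_ : Fin N → Edge N → Set
x ∈ᴱ (u , v) = x ≡ u ⊎ x ≡ v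

_∈ᴱ?_ : (x : Fin N) (e : Edge N) → Dec (x ∈ᴱ e)
x ∈ᴱ? (u , v) = x ≟ u ⊎-dec x ≟ v

Meets : Edge N → Edge N → Set
Meets e f = ∃ λ x → x ∈ᴱ e × x ∈ᴱ f

meets? : (e f : Edge N) → Dec (Meets e f)
meets? e f = any? λ x → x ∈ᴱ? e ×-dec x ∈ᴱ? f

Joins : Edge N → Fin N → Fin N → Set
Joins e x y = e ≡ (x , y) ⊎ e ≡ (y , x)

joins : x ∈ᴱ e → ∃ λ y → Joins e x y
joins (inj₁ refl) = _ , inj₁ refl
joins (inj₂ refl) = _ , inj₂ refl

joins-both : x ∈ᴱ e → y ∈ᴱ e → x ≢ y → Joins e x y
joins-both (inj₁ refl) (inj₁ refl) x≢y = contradiction refl x≢y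
joins-both (inj₁ refl) (inj₂ refl) x≢y = inj₁ refl
joins-both (inj₂ refl) (inj₁ refl) x≢y = inj₂ refl
joins-both (inj₂ refl) (inj₂ refl) x≢y = contradiction refl x≢y

joins-ends : Joins e x y → z ∈ᴱ e → z ≡ x ⊎ z ≡ y
joins-ends (inj₁ refl) z∈         = z∈
joins-ends (inj₂ refl) (inj₁ z≡y) = inj₂ z≡y
joins-ends (inj₂ refl) (inj₂ z≡x) = inj₁ z≡x

joins-unique : Increasing e → Increasing f → Joins e x y → Joins f x y → e ≡ f
joins-unique e< f< (inj₁ refl) (inj₁ refl) = refl
joins-unique e< f< (inj₁ refl) (inj₂ refl) = contradiction f< (<-asym e<)
joins-unique e< f< (inj₂ refl) (inj₁ refl) = contradiction f< (<-asym e<)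
joins-unique e< f< (inj₂ refl) (inj₂ refl) = refl

other-end : Increasing e → Increasing f → e ≢ f → Joins e x y → Joins f x z → y ≢ z
other-end e< f< e≢f e-xy f-xz refl = e≢f (joins-unique e< f< e-xy f-xz)

meets-other-end : Meets h e → Joins e x y → ¬ x ∈ᴱ h → y ∈ᴱ h
meets-other-end (w , w∈h , w∈e) e-xy x∉h with joins-ends e-xy w∈e
... | inj₁ refl = contradiction w∈h x∉h
... | inj₂ refl = w∈h

-- If `h` missed `x`, it would contain the other ends of `e`, `f` and `g`. These are three distinct
-- vertices, and `h` has only two.
meets-claw : Increasing e → Increasing f → Increasing g → e ≢ f → e ≢ g → f ≢ g →
             x ∈ᴱ e → x ∈ᴱ f → x ∈ᴱ g → Meets h e → Meets h f → Meets h g → x ∈ᴱ h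
meets-claw {x = x} {h = h} e< f< g< e≢f e≢g f≢g x∈e x∈f x∈g h-e h-f h-g with x ∈ᴱ? h
... | yes x∈h = x∈h
... | no  x∉h with joins x∈e | joins x∈f | joins x∈g
... | _ , e-xu | _ , f-xv | _ , g-xw
  with joins-ends (joins-both {e = h} (meets-other-end h-e e-xu x∉h) (meets-other-end h-f f-xv x∉h)
                     (other-end e< f< e≢f e-xu f-xv))
                  (meets-other-end h-g g-xw x∉h)
... | inj₁ w≡u = contradiction (sym w≡u) (other-end e< g< e≢g e-xu g-xw)
... | inj₂ w≡v = contradiction (sym w≡v) (other-end f< g< f≢g f-xv g-xw)

-- An edge that avoids `x` but meets `e` and `f` contains the other end of each, so it is the third
-- side of their triangle.
closes-triangle-unique :
  Increasing e → Increasing f → Increasing g → Increasing h → e ≢ f → x ∈ᴱ e → x ∈ᴱ f →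
  Meets g e → Meets g f → ¬ x ∈ᴱ g → Meets h e → Meets h f → ¬ x ∈ᴱ h → g ≡ h
closes-triangle-unique {g = g} {h} e< f< g< h< e≢f x∈e x∈f g-e g-f x∉g h-e h-f x∉h
  with joins x∈e | joins x∈f
... | _ , e-xu | _ , f-xv =
  joins-unique g< h<
    (joins-both {e = g} (meets-other-end g-e e-xu x∉g) (meets-other-end g-f f-xv x∉g) u≢v)
    (joins-both {e = h} (meets-other-end h-e e-xu x∉h) (meets-other-end h-f f-xv x∉h) u≢v)
  where u≢v = other-end e< f< e≢f e-xu f-xv

-- Pairwise intersecting edges form a star or lie in a triangle, and a triangle has only three
-- edges. The conclusion covers every `h` that meets the family, so it also applies to edges outside
-- the list.
four-intersecting⇒star :
  {es : List (Edge N)} → Unique es → 4 ≤ length es → All Increasing es →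
  (∀ {e f} → e ∈ es → f ∈ es → Meets e f) →
  ∃ λ x → ∀ {h} → (∀ {e} → e ∈ es → Meets h e) → x ∈ᴱ h
four-intersecting⇒star {es = e₁ ∷ e₂ ∷ e₃ ∷ e₄ ∷ _}
  ((e₁≢e₂ ∷ e₁≢e₃ ∷ e₁≢e₄ ∷ _) ∷ (e₂≢e₃ ∷ e₂≢e₄ ∷ _) ∷ (e₃≢e₄ ∷ _) ∷ _)
  (s≤s (s≤s (s≤s (s≤s _)))) (e₁< ∷ e₂< ∷ e₃< ∷ e₄< ∷ _) meets
  with meets {e₁} {e₂} (here refl) (there (here refl))
... | x , x∈e₁ , x∈e₂ with x ∈ᴱ? e₃ | x ∈ᴱ? e₄
... | yes x∈e₃ | _ = x , λ h-es →
  meets-claw e₁< e₂< e₃< e₁≢e₂ e₁≢e₃ e₂≢e₃ x∈e₁ x∈e₂ x∈e₃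
    (h-es (here refl)) (h-es (there (here refl))) (h-es (there (there (here refl))))
... | no _ | yes x∈e₄ = x , λ h-es →
  meets-claw e₁< e₂< e₄< e₁≢e₂ e₁≢e₄ e₂≢e₄ x∈e₁ x∈e₂ x∈e₄
    (h-es (here refl)) (h-es (there (here refl))) (h-es (there (there (there (here refl)))))
-- If both miss `x`, then `e₃` and `e₄` are the same third side of the triangle on `e₁` and `e₂`.
... | no x∉e₃ | no x∉e₄ = contradiction
  (closes-triangle-unique e₁< e₂< e₃< e₄< e₁≢e₂ x∈e₁ x∈e₂
    (meets e₃∈ (here refl)) (meets e₃∈ (there (here refl))) x∉e₃
    (meets e₄∈ (here refl)) (meets e₄∈ (there (here refl))) x∉e₄)
  e₃≢e₄
  where
  e₃∈ = there (there (here refl))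
  e₄∈ = there (there (there (here refl)))

-- Edges spanned by a sorted list of vertices

edges : List (Fin N) → List (Edge N)
edges []       = []
edges (v ∷ vs) = map (v ,_) vs ++ edges vs

∈-edges⁻ : {vs : List (Fin N)} → AllPairs _<_ vs → e ∈ edges vs →
           Increasing e × proj₁ e ∈ vs × proj₂ e ∈ vs
∈-edges⁻ {vs = v ∷ vs} (v< ∷ sorted) e∈ with ∈-++⁻ (map (v ,_) vs) e∈
... | inj₂ e∈vs with ∈-edges⁻ sorted e∈vs
...   | e< , p , q = e< , there p , there q
∈-edges⁻ {vs = v ∷ vs} (v< ∷ sorted) e∈ | inj₁ e∈v with ∈-map⁻ (v ,_) e∈v
...   | w , w∈ , refl = All.lookup v< w∈ , here refl , there w∈

edges-unique : {vs : List (Fin N)} → AllPairs _<_ vs → Unique (edges vs)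
edges-unique []                       = []
edges-unique {vs = v ∷ vs} (v< ∷ sorted) =
  Unique.++⁺ (Unique.map⁺ (cong proj₂) (AllPairs.map <⇒≢ sorted)) (edges-unique sorted)
    λ (e∈v , e∈vs) → v∉ (subst (_∈ vs) (first e∈v) (proj₁ (proj₂ (∈-edges⁻ sorted e∈vs))))
  where
  v∉ : ¬ v ∈ vs
  v∉ v∈ = <⇒≢ (All.lookup v< v∈) refl

  first : ∀ {e} → e ∈ map (v ,_) vs → proj₁ e ≡ v
  first e∈ = cong proj₁ (proj₂ (proj₂ (∈-map⁻ (v ,_) e∈)))

-- A linear bound below the binomial coefficient, tight for three and four vertices: a triangle
-- gives the base case, and each further vertex adds at least three edges.
edges-length : ∀ k {vs : List (Fin N)} → 3 + k ≤ length vs → 3 * suc k ≤ length (edges vs)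
edges-length k {v ∷ vs} (s≤s large) rewrite length-++ (map (v ,_) vs) {edges vs} | length-map (v ,_) vs
  with k
... | zero with vs | large
...   | _ ∷ _ ∷ _ | s≤s (s≤s _) = s≤s (s≤s (≤-trans (s≤s z≤n) (ℕ.m≤n+m _ _)))
edges-length k {v ∷ vs} (s≤s large) | suc k′ = begin
  3 * (2 + k′)                   ≡⟨ ℕ.*-suc 3 (suc k′) ⟩
  3 + 3 * suc k′                 ≤⟨ ℕ.+-mono-≤ (≤-trans (ℕ.m≤m+n 3 k′) large) (edges-length k′ {vs} large) ⟩
  length vs + length (edges vs)  ∎
  where open ℕ.≤-Reasoning

-- Monochromatic disjoint edges after two deletions

module _ {N K : ℕ} (col : Edge N → Fin K) (d₁ d₂ : Edge N) where

  -- The pairs `d₁` and `d₂` are the deleted edges. They may coincide or lie on the diagonal, so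
  -- fewer than two deletions are covered as well.
  Live : Edge N → Set
  Live e = Increasing e × e ≢ d₁ × e ≢ d₂

  live? : ∀ e → Dec (Live e)
  live? e = proj₁ e <? proj₂ e ×-dec ¬? (e ≟ᴱ d₁) ×-dec ¬? (e ≟ᴱ d₂)

  -- A monochromatic `2K₂` among the surviving edges.
  Clash : Edge N → Edge N → Set
  Clash e f = Live e × Live f × col e ≡ col f × ¬ Meets e f

  clash? : ∀ e f → Dec (Clash e f)
  clash? e f = live? e ×-dec live? f ×-dec col e ≟ col f ×-dec ¬? (meets? e f)

  ClashFree : Set
  ClashFree = ∀ {e f} → ¬ Clash e f

  clash-free⇒meets : ClashFree → ∀ {e f} → Live e → Live f → col e ≡ col f → Meets e f
  clash-free⇒meets clash-free {e} {f} live-e live-f same with meets? e f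
  ... | yes meets = meets
  ... | no ¬meets = contradiction (live-e , live-f , same , ¬meets) clash-free

  live-edges : List (Fin N) → List (Edge N)
  live-edges vs = remove _≟ᴱ_ d₂ (remove _≟ᴱ_ d₁ (edges vs))

  ∈-live-edges⁻ : ∀ {vs e} → AllPairs _<_ vs → e ∈ live-edges vs →
                  Live e × proj₁ e ∈ vs × proj₂ e ∈ vs
  ∈-live-edges⁻ {vs} sorted e∈
    with ∈-filter⁻ (λ e → ¬? (e ≟ᴱ d₂)) {xs = remove _≟ᴱ_ d₁ (edges vs)} e∈
  ... | e∈′ , e≢d₂ with ∈-filter⁻ (λ e → ¬? (e ≟ᴱ d₁)) {xs = edges vs} e∈′
  ... | e∈″ , e≢d₁ with ∈-edges⁻ sorted e∈″
  ... | e< , ends∈ = (e< , e≢d₁ , e≢d₂) , ends∈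

  live-edges-unique : ∀ {vs} → AllPairs _<_ vs → Unique (live-edges vs)
  live-edges-unique sorted = Unique.filter⁺ _ (Unique.filter⁺ _ (edges-unique sorted))

  live-edges-length : ∀ k {vs} → AllPairs _<_ vs → 3 + k ≤ length vs →
                      3 * k ℕ.< length (live-edges vs)
  -- Adding the two deleted edges to the required `3 * k + 1` gives `3 * suc k`, the bound of
  -- `edges-length`.
  live-edges-length k {vs} sorted large = ℕ.+-cancelˡ-≤ 2 _ _ (begin
    3 + 3 * k                                 ≡⟨ ℕ.*-suc 3 k ⟨
    3 * suc k                                 ≤⟨ edges-length k {vs} large ⟩
    length (edges vs)                         ≤⟨ length-remove _≟ᴱ_ (edges-unique sorted) ⟩
    suc (length (remove _≟ᴱ_ d₁ (edges vs)))  ≤⟨ s≤s (length-remove _≟ᴱ_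
                                                   (Unique.filter⁺ _ (edges-unique sorted))) ⟩
    2 + length (live-edges vs)                ∎)
    where open ℕ.≤-Reasoning

  -- More than `3 * k` live edges share at most `k` colours, so four have the same colour `c`.
  -- Without a clash they pairwise meet and form a star, and every live edge of colour `c`, inside
  -- `vs` or not, meets all four and hence contains the centre.
  clash-free⇒star-colour :
    ClashFree → ∀ {k cs vs} → length cs ≤ k → 3 + k ≤ length vs → AllPairs _<_ vs →
    (∀ {u v} → u ∈ vs → v ∈ vs → Live (u , v) → col (u , v) ∈ cs) →
    ∃₂ λ c x → c ∈ cs × (∀ {e} → Live e → col e ≡ c → x ∈ᴱ e)
  clash-free⇒star-colour clash-free {k} {cs} {vs} cs≤k large sorted coloured
    with generalised-pigeonhole _≟_ col 3 cs (live-edges-unique sorted)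
           (λ e∈ → let live , u∈ , v∈ = ∈-live-edges⁻ {vs} sorted e∈ in coloured u∈ v∈ live)
           (ℕ.<-≤-trans (s≤s (ℕ.*-monoʳ-≤ 3 cs≤k)) (live-edges-length k {vs} sorted large))
  ... | c , c∈ , es , es-unique , es-large , es⊆
    with four-intersecting⇒star es-unique es-large
           (All.tabulate λ e∈ → proj₁ (live e∈))
           (λ e∈ f∈ → clash-free⇒meets clash-free (live e∈) (live f∈)
                        (trans (proj₂ (es⊆ e∈)) (sym (proj₂ (es⊆ f∈)))))
    where
    live : ∀ {e} → e ∈ es → Live e
    live e∈ = proj₁ (∈-live-edges⁻ {vs} sorted (proj₁ (es⊆ e∈)))
  ... | x , star = c , x , c∈ , λ live-e e-c → star λ f∈ →
    clash-free⇒meets clash-free live-e (proj₁ (∈-live-edges⁻ {vs} sorted (proj₁ (es⊆ f∈))))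
      (trans e-c (sym (proj₂ (es⊆ f∈))))

  -- Induction on `k`: removing the centre `x` from `vs` destroys every live edge of colour `c`, so
  -- `c` can be removed from `cs` and all hypotheses persist for `k - 1`.
  clash-free⇒many-colours :
    ClashFree → ∀ k {cs vs} → length cs ≤ k → 3 + k ≤ length vs → AllPairs _<_ vs →
    ¬ (∀ {u v} → u ∈ vs → v ∈ vs → Live (u , v) → col (u , v) ∈ cs)
  clash-free⇒many-colours clash-free k {cs} {vs} cs≤k large sorted coloured
    with clash-free⇒star-colour clash-free cs≤k large sorted coloured
  -- For `k = 0` the list `cs` is empty and cannot contain the colour `c` just found.
  clash-free⇒many-colours clash-free zero {_ ∷ _} () large sorted coloured | c , x , c∈ , star
  clash-free⇒many-colours clash-free (suc k) {cs} {vs} cs≤k large sorted coloured | c , x , c∈ , star =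
    clash-free⇒many-colours clash-free k {remove _≟_ c cs} {remove _≟_ x vs}
      (ℕ.≤-pred (≤-trans (filter-notAll _ cs (Any.map (λ c≡y y≢c → y≢c (sym c≡y)) c∈)) cs≤k))
      (ℕ.≤-pred (≤-trans large (length-remove _≟_ (AllPairs.map <⇒≢ sorted))))
      (AllPairs.filter⁺ _ sorted)
      λ u∈ v∈ live →
        let u∈vs , u≢x = ∈-filter⁻ _ {xs = vs} u∈
            v∈vs , v≢x = ∈-filter⁻ _ {xs = vs} v∈
        in ∈-filter⁺ _ (coloured u∈vs v∈vs live)
             λ uv-c → [ u≢x ∘ sym , v≢x ∘ sym ]′ (star live uv-c)

  clash-exists : 3 + K ≤ N → ∃₂ Clash
  clash-exists large
    -- The counting argument only refutes the absence of a clash; the exhaustive search turns this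
    -- into a witness.
    with any? (λ u → any? λ v → any? λ w → any? λ x → clash? (u , v) (w , x))
  ... | yes (u , v , w , x , clash) = (u , v) , (w , x) , clash
  ... | no ¬clash = ⊥-elim
    (clash-free⇒many-colours (λ clash → ¬clash (_ , _ , _ , _ , clash)) K {allFin K} {allFin N}
      (≤-reflexive (length-tabulate {n = K} id))
      (≤-trans large (≤-reflexive (sym (length-tabulate {n = N} id))))
      (AllPairs.tabulate⁺-< id) λ _ _ _ → ∈-allFin _)

-- Copies of a graph as images of injections

open Equivalence using () renaming (to to ⇒; from to ⇐)

-- If `y` were missed, punching it out of the codomain would inject `Fin (suc n)` into `Fin n`.
injective⇒surjective : ∀ {n} {f : Fin n → Fin n} → Injective _≡_ _≡_ f → ∀ y → ∃ λ x → f x ≡ y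
injective⇒surjective {suc n} {f} inj y with any? (λ x → f x ≟ y)
... | yes hit  = hit
... | no  miss = contradiction
  (injective⇒≤ λ {i} {j} eq → inj (punchOut-injective (avoids i) (avoids j) eq))
  ℕ.1+n≰n
  where
  avoids : ∀ x → y ≢ f x
  avoids x y≡fx = miss (x , sym y≡fx)

T-ext : ∀ {a b} → (T a → T b) → (T b → T a) → a ≡ b
T-ext {a} {b} a⇒b b⇒a = does-⇔ (mk⇔ a⇒b b⇒a) (T? a) (T? b)

module _ {n N : ℕ} (G : Graph n) {t : Fin n → Fin N} (inj : Injective _≡_ _≡_ t) where

  private
    vertex? : ∀ v → Dec (∃ λ i → t i ≡ v)
    vertex? v = any? λ i → t i ≟ v

    edge? : ∀ u v → Dec (∃₂ λ i j → t i ≡ u × t j ≡ v × Graph.Adj G i j)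
    edge? u v = any? λ i → any? λ j → t i ≟ u ×-dec t j ≟ v ×-dec T? _

    edge-sym : ∀ {u v} → T ⌊ edge? u v ⌋ → T ⌊ edge? v u ⌋
    edge-sym uv with toWitness uv
    ... | i , j , ti , tj , ij = fromWitness (j , i , tj , ti , subst T (Graph.adj-sym G i j) ij)

    edge-irrefl : ∀ v → ¬ T ⌊ edge? v v ⌋
    edge-irrefl v vv with toWitness vv
    ... | i , j , ti , tj , ij = Graph.Adj⇒≢ G ij (inj (trans ti (sym tj)))

    ∈-vertices : ∀ v → v Subset.∈ tabulate (λ v → ⌊ vertex? v ⌋) ⇔ (∃ λ i → t i ≡ v)
    ∈-vertices v = mk⇔
      (λ v∈ → toWitness (⇐ T-≡ (trans (sym (lookup∘tabulate _ v)) ([]=⇒lookup v∈))))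
      (λ hit → lookup⇒[]= v _ (trans (lookup∘tabulate _ v) (⇒ T-≡ (fromWitness hit))))

  imageGraph : Subgraph N
  imageGraph = record
    { vertices = tabulate λ v → ⌊ vertex? v ⌋
    ; graph    = record
      { adj        = λ u v → ⌊ edge? u v ⌋
      ; adj-sym    = λ u v → T-ext (edge-sym {u} {v}) (edge-sym {v} {u})
      ; adj-irrefl = λ v → T-ext (⊥-elim ∘ edge-irrefl v) λ ()
      }
    ; endpoint = λ {u} {v} uv → let i , _ , ti , _ = toWitness uv in ⇐ (∈-vertices u) (i , ti)
    }

  imageGraph-adj⁻ : ∀ {u v} → Subgraph.Adj imageGraph u v →
                    ∃₂ λ i j → t i ≡ u × t j ≡ v × Graph.Adj G i j
  imageGraph-adj⁻ = toWitness

  imageGraph-adj⁺ : ∀ {i j} → Graph.Adj G i j → Subgraph.Adj imageGraph (t i) (t j)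
  imageGraph-adj⁺ ij = fromWitness (_ , _ , refl , refl , ij)

  imageGraph-copy : G ≅ imageGraph
  imageGraph-copy = record
    { to        = t
    ; injective = inj
    ; image     = ∈-vertices
    ; adj-to    = λ i j → T-ext
        (λ titj → let _ , _ , ti , tj , ij = toWitness titj
                  in subst₂ (Graph.Adj G) (inj ti) (inj tj) ij)
        imageGraph-adj⁺
    }

-- Matchings with prescribed ends, and counting

private variable
  k : ℕ

lookup-inj : ∀ {n} {vs : Vec (Fin N) n} → Vec.Unique vs → Injective _≡_ _≡_ (lookup vs)
lookup-inj uniq = lookup-injective uniq _ _

2K₂-edges : ∀ {i j} → Graph.Adj 2K₂ i j →
            ((i , j) ≡ (0F , 1F) ⊎ (i , j) ≡ (1F , 0F)) ⊎ ((i , j) ≡ (2F , 3F) ⊎ (i , j) ≡ (3F , 2F))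
2K₂-edges {0F} {1F} _ = inj₁ (inj₁ refl)
2K₂-edges {1F} {0F} _ = inj₁ (inj₂ refl)
2K₂-edges {2F} {3F} _ = inj₂ (inj₁ refl)
2K₂-edges {3F} {2F} _ = inj₂ (inj₂ refl)

module _ {a b c d : Fin N} (uniq : Vec.Unique (a ∷ b ∷ c ∷ d ∷ [])) where

  -- The order of the four vertices fixes the pairing: the edges are `a b` and `c d`.
  matching : Subgraph N
  matching = imageGraph 2K₂ (lookup-inj uniq)

  matching-adj⁻ : ∀ {u v} → Subgraph.Adj matching u v →
                  ((u , v) ≡ (a , b) ⊎ (u , v) ≡ (b , a)) ⊎ ((u , v) ≡ (c , d) ⊎ (u , v) ≡ (d , c))
  matching-adj⁻ uv with imageGraph-adj⁻ 2K₂ (lookup-inj uniq) uv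
  ... | _ , _ , refl , refl , ij with 2K₂-edges ij
  ... | inj₁ (inj₁ refl) = inj₁ (inj₁ refl)
  ... | inj₁ (inj₂ refl) = inj₁ (inj₂ refl)
  ... | inj₂ (inj₁ refl) = inj₂ (inj₁ refl)
  ... | inj₂ (inj₂ refl) = inj₂ (inj₂ refl)

  matching-monochromatic : (χ : Coloring N k) (a≢b : a ≢ b) (c≢d : c ≢ d) →
                           Coloring.color χ a b a≢b ≡ Coloring.color χ c d c≢d → Monochromatic χ matching
  matching-monochromatic χ a≢b c≢d same e f = trans (edge-color e) (sym (edge-color f))
    where
    open Coloring χ
    edge-color : ∀ {u v} (e : Subgraph.Adj matching u v) →
                 color u v (Subgraph.Adj⇒≢ matching e) ≡ color a b a≢b
    edge-color e with Subgraph.Adj⇒≢ matching e | matching-adj⁻ e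
    ... | _ | inj₁ (inj₁ refl) = refl
    ... | _ | inj₁ (inj₂ refl) = sym (color-sym a b a≢b)
    ... | _ | inj₂ (inj₁ refl) = sym same
    ... | _ | inj₂ (inj₂ refl) = trans (sym (color-sym c d c≢d)) (sym same)

disjoint-edges-unique : {e f : Edge N} → Increasing e → Increasing f → ¬ Meets e f →
                        Vec.Unique (proj₁ e ∷ proj₂ e ∷ proj₁ f ∷ proj₂ f ∷ [])
disjoint-edges-unique {e = a , b} {f = c , d} a<b c<d apart =
  (<⇒≢ a<b ∷ (λ a≡c → apart (a , inj₁ refl , inj₁ a≡c)) ∷ (λ a≡d → apart (a , inj₁ refl , inj₂ a≡d)) ∷ []) ∷
  ((λ b≡c → apart (b , inj₂ refl , inj₁ b≡c)) ∷ (λ b≡d → apart (b , inj₂ refl , inj₂ b≡d)) ∷ []) ∷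
  (<⇒≢ c<d ∷ []) ∷ [] ∷ []

module _ {P : Subgraph N → Set} {c : ℕ} (count : HasCount P c) where
  open Setoid (subgraphs N) using (_≈_)
  open Inverse count using (from; inverseˡ; strictlyInverseˡ)

  -- Subgraphs with the same index under `from` are equal, so pairwise distinct solutions have
  -- distinct indices in `Fin c`.
  HasCount⇒≤ : ∀ {n} (S : Fin n → ∃ P) → (∀ {i j} → i < j → ¬ proj₁ (S i) ≈ proj₁ (S j)) → n ≤ c
  HasCount⇒≤ S distinct = injective⇒≤ injective
    where
    same-index : ∀ X Y → from X ≡ from Y → proj₁ X ≈ proj₁ Y
    same-index X Y eq with strictlyInverseˡ X | inverseˡ {Y} eq
    ... | vX , aX | vY , aY = trans (sym vX) vY , λ i j → trans (sym (aX i j)) (aY i j)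

    injective : ∀ {i j} → from (S i) ≡ from (S j) → i ≡ j
    injective {i} {j} eq with Fin.<-cmp i j
    ... | tri< i<j _ _ = contradiction (same-index (S i) (S j) eq) (distinct i<j)
    ... | tri≈ _ i≡j _ = i≡j
    ... | tri> _ _ j<i = contradiction (same-index (S j) (S i) (sym eq)) (distinct j<i)

-- Three monochromatic copies in every colouring

module _ {N k : ℕ} (χ : Coloring N (suc k)) where
  open Coloring χ

  -- The value on the diagonal is irrelevant.
  edgeColor : Edge N → Fin (suc k)
  edgeColor (u , v) with u ≟ v
  ... | yes _   = zero
  ... | no  u≢v = color u v u≢v

  edgeColor-≢ : ∀ {u v} (u≢v : u ≢ v) → edgeColor (u , v) ≡ color u v u≢v
  edgeColor-≢ {u} {v} u≢v with u ≟ v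
  ... | yes u≡v = contradiction u≡v u≢v
  ... | no  _   = refl

  module _ {d₁ d₂ e f : Edge N} (clash : Clash edgeColor d₁ d₂ e f) where

    private
      e-live = proj₁ clash
      f-live = proj₁ (proj₂ clash)

    clash-unique : Vec.Unique (proj₁ e ∷ proj₂ e ∷ proj₁ f ∷ proj₂ f ∷ [])
    clash-unique = disjoint-edges-unique (proj₁ e-live) (proj₁ f-live) (proj₂ (proj₂ (proj₂ clash)))

    clash-matching : Subgraph N
    clash-matching = matching clash-unique

    clash-copy : MonochromaticCopy χ 2K₂ clash-matching
    clash-copy = let (e< , _) , (f< , _) , same , _ = clash in
      imageGraph-copy 2K₂ (lookup-inj clash-unique) ,
      matching-monochromatic clash-unique χ (<⇒≢ e<) (<⇒≢ f<)
        (trans (sym (edgeColor-≢ (<⇒≢ e<))) (trans same (edgeColor-≢ (<⇒≢ f<))))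

    clash-adj : Subgraph.Adj clash-matching (proj₁ e) (proj₂ e)
    clash-adj = imageGraph-adj⁺ 2K₂ (lookup-inj clash-unique) {0F} {1F} _

    clash-adj⁻ : ∀ {u v} → u < v → Subgraph.Adj clash-matching u v → (u , v) ≢ d₁ × (u , v) ≢ d₂
    clash-adj⁻ u<v uv with matching-adj⁻ clash-unique uv
    ... | inj₁ (inj₁ refl) = proj₂ e-live
    ... | inj₁ (inj₂ refl) = contradiction u<v (Fin.<-asym (proj₁ e-live))
    ... | inj₂ (inj₁ refl) = proj₂ f-live
    ... | inj₂ (inj₂ refl) = contradiction u<v (Fin.<-asym (proj₁ f-live))

  -- The field `edge` records one edge of the copy, to be deleted before the next copy is sought.
  record CopyAvoiding (d₁ d₂ : Edge N) : Set where
    field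
      {subgraph}  : Subgraph N
      copy        : MonochromaticCopy χ 2K₂ subgraph
      {edge}      : Edge N
      increasing  : Increasing edge
      edge∈       : Subgraph.Adj subgraph (proj₁ edge) (proj₂ edge)
      avoids      : ∀ {u v} → u < v → Subgraph.Adj subgraph u v → (u , v) ≢ d₁ × (u , v) ≢ d₂

  open CopyAvoiding

  copyAvoiding : 3 + suc k ≤ N → ∀ d₁ d₂ → CopyAvoiding d₁ d₂
  copyAvoiding large d₁ d₂ = let _ , _ , clash = clash-exists edgeColor d₁ d₂ large in record
    { copy       = clash-copy clash
    ; increasing = proj₁ (proj₁ clash)
    ; edge∈      = clash-adj clash
    ; avoids     = clash-adj⁻ clash
    }

  monochromatic-2K₂ : 3 + suc k ≤ N → ∃ (MonochromaticCopy χ 2K₂)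
  -- The pattern exposes `N` as a successor, so that `0F` exists; the pair `(0F , 0F)` is not
  -- increasing, so nothing is deleted.
  monochromatic-2K₂ large@(s≤s _) = _ , copy (copyAvoiding large (0F , 0F) (0F , 0F))

  -- The recorded edge of `C` lies in `C` but was deleted before `D` was found.
  copies-distinct : ∀ {d₁ d₂ d₁′ d₂′} (C : CopyAvoiding d₁ d₂) (D : CopyAvoiding d₁′ d₂′) →
                    edge C ≡ d₁′ ⊎ edge C ≡ d₂′ →
                    ¬ Setoid._≈_ (subgraphs N) (subgraph C) (subgraph D)
  copies-distinct C D avoided (_ , adj≡)
    with avoids D (increasing C) (subst T (adj≡ _ _) (edge∈ C))
  ... | ≢d₁′ , ≢d₂′ = [ ≢d₁′ , ≢d₂′ ]′ avoided

  -- The diagonal pair (0F , 0F) is not an edge, so avoiding it is no constraint.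
  monochromatic-2K₂-count : 3 + suc k ≤ N → ∀ {b} → HasCount (MonochromaticCopy χ 2K₂) b → 3 ≤ b
  monochromatic-2K₂-count large@(s≤s _) count with copyAvoiding large (0F , 0F) (0F , 0F)
  ... | C₁ with copyAvoiding large (edge C₁) (edge C₁)
  ... | C₂ with copyAvoiding large (edge C₁) (edge C₂)
  ... | C₃ = HasCount⇒≤ count
    (λ { 0F → _ , copy C₁ ; 1F → _ , copy C₂ ; 2F → _ , copy C₃ })
    λ { {0F} {1F} _ → copies-distinct C₁ C₂ (inj₁ refl)
      ; {0F} {2F} _ → copies-distinct C₁ C₃ (inj₁ refl)
      ; {1F} {2F} _ → copies-distinct C₂ C₃ (inj₂ refl)
      ; {1F} {1F} (s≤s ()) ; {2F} {1F} (s≤s ()) ; {2F} {2F} (s≤s (s≤s ())) }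

-- A copy of `2K₂` is determined by its vertices and one edge

-- Given an edge u v of a perfect matching on four vertices, distinct vertices x and y are
-- matched iff both or neither of them lie on u v.
matchedBy : (u v x y : Fin N) → Bool
matchedBy u v x y = not (does (x ≟ y)) ∧ not (on x xor on y)
  where
  on : Fin _ → Bool
  on z = does (z ≟ u) ∨ does (z ≟ v)

-- A finite statement about four vertices, settled by evaluating its decision procedure.
2K₂-matchedBy : ∀ i j x y → Graph.Adj 2K₂ i j → Graph.adj 2K₂ x y ≡ matchedBy i j x y
2K₂-matchedBy = toWitness
  {a? = all? λ i → all? λ j → all? λ x → all? λ y →
          T? (Graph.adj 2K₂ i j) →-dec Graph.adj 2K₂ x y Bool.≟ matchedBy i j x y} _

module _ {n : ℕ} {t : Fin n → Fin N} (inj : Injective _≡_ _≡_ t) where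

  does-≟-injective : ∀ i j → does (t i ≟ t j) ≡ does (i ≟ j)
  does-≟-injective i j = does-⇔ (mk⇔ inj (cong t)) (t i ≟ t j) (i ≟ j)

  -- `matchedBy` consults only equality tests, which an injection preserves; this carries the check
  -- on `Fin 4` over to any copy.
  matchedBy-injective : ∀ u v x y → matchedBy (t u) (t v) (t x) (t y) ≡ matchedBy u v x y
  matchedBy-injective u v x y
    rewrite does-≟-injective x y | does-≟-injective x u | does-≟-injective x v
          | does-≟-injective y u | does-≟-injective y v = refl

module _ {S : Subgraph N} (copy : 2K₂ ≅ S) where
  open Subgraph S
  open _≅_ copy

  copy-matchedBy : ∀ {u v x y} → Adj u v → x Subset.∈ vertices → y Subset.∈ vertices →
                   adj x y ≡ matchedBy u v x y
  copy-matchedBy {u} {v} {x} {y} uv x∈ y∈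
    with ⇒ (image u) (endpoint uv) | ⇒ (image v) (endpoint (subst T (adj-sym u v) uv))
       | ⇒ (image x) x∈ | ⇒ (image y) y∈
  ... | i , refl | j , refl | p , refl | q , refl = begin
    adj (to p) (to q)                       ≡⟨ adj-to p q ⟩
    Graph.adj 2K₂ p q                       ≡⟨ 2K₂-matchedBy i j p q (subst T (adj-to i j) uv) ⟩
    matchedBy i j p q                       ≡⟨ matchedBy-injective injective i j p q ⟨
    matchedBy (to i) (to j) (to p) (to q)   ∎
    where open ≡-Reasoning

nonvertex-adj : (S : Subgraph N) → ∀ {x y} →
                ¬ (x Subset.∈ Subgraph.vertices S × y Subset.∈ Subgraph.vertices S) →
                Subgraph.adj S x y ≡ false
nonvertex-adj S {x} {y} ∉ = T-ext {b = false}
  (λ xy → ∉ (Subgraph.endpoint S xy , Subgraph.endpoint S (subst T (Subgraph.adj-sym S x y) xy))) λ ()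

-- On the common vertex set the shared edge determines all adjacencies through `matchedBy`;
-- elsewhere both graphs have no edges.
2K₂-copies-sharing-edge : {S S′ : Subgraph N} → 2K₂ ≅ S → 2K₂ ≅ S′ →
  Subgraph.vertices S ≡ Subgraph.vertices S′ →
  ∀ {u v} → Subgraph.Adj S u v → Subgraph.Adj S′ u v → Setoid._≈_ (subgraphs N) S S′
2K₂-copies-sharing-edge {S = S} {S′} copy copy′ V≡V′ uv uv′ = V≡V′ , adj≡
  where
  adj≡ : ∀ x y → Subgraph.adj S x y ≡ Subgraph.adj S′ x y
  adj≡ x y with x ∈? Subgraph.vertices S ×-dec y ∈? Subgraph.vertices S
  ... | no ∉ = trans (nonvertex-adj S ∉)
    (sym (nonvertex-adj S′ (∉ ∘ λ (x∈ , y∈) →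
      subst (x Subset.∈_) (sym V≡V′) x∈ , subst (y Subset.∈_) (sym V≡V′) y∈)))
  ... | yes (x∈ , y∈) = trans (copy-matchedBy copy uv x∈ y∈)
    (sym (copy-matchedBy copy′ uv′ (subst (x Subset.∈_) V≡V′ x∈) (subst (y Subset.∈_) V≡V′ y∈)))

2K₂-partner : ∀ i → ∃ (Graph.Adj 2K₂ i)
2K₂-partner 0F = 1F , _
2K₂-partner 1F = 0F , _
2K₂-partner 2F = 3F , _
2K₂-partner 3F = 2F , _

-- The nested star colouring

-- Truncated subtraction of `s` is injective from `s` onwards, so distinct arguments can only
-- collide at the value 0.
∸-collision : ∀ {m n} s → m ≢ n → m ∸ s ≡ n ∸ s → m ≤ s
∸-collision {m} {n} s m≢n eq with m ℕ.≤? s | n ℕ.≤? s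
... | yes m≤s | _       = m≤s
... | no  m≰s | no  n≰s = contradiction (ℕ.∸-cancelʳ-≡ (ℕ.≰⇒≥ m≰s) (ℕ.≰⇒≥ n≰s) eq) m≢n
... | no  m≰s | yes n≤s = ℕ.m∸n≡0⇒m≤n (trans eq (ℕ.m≤n⇒m∸n≡0 n≤s))

-- A pair with maximum m has colour m ∸ (s + 1): the first s + 2 vertices span a clique of
-- colour 0, and every later vertex is the centre of a star towards the smaller ones.
nestedStars : ∀ s k → Coloring (suc s + suc k) (suc k)
nestedStars s k = record
  { color     = λ i j _ → fromℕ< (bound i j)
  ; color-sym = λ i j _ → Fin.fromℕ<-cong _ _ (cong (_∸ suc s) (ℕ.⊔-comm (toℕ i) (toℕ j)))
                                          (bound i j) (bound j i)
  }
  where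
  bound : ∀ i j → toℕ i ⊔ toℕ j ∸ suc s ℕ.< suc k
  bound i j = ℕ.m<n+o⇒m∸n<o (toℕ i ⊔ toℕ j) (suc s) (ℕ.⊔-pres-<m (Fin.toℕ<n i) (Fin.toℕ<n j))

module _ {s k : ℕ} where
  open Coloring (nestedStars s k)

  toℕ-color : ∀ i j .(i≢j : i ≢ j) → toℕ (color i j i≢j) ≡ toℕ i ⊔ toℕ j ∸ suc s
  toℕ-color i j _ = Fin.toℕ-fromℕ< _

  -- Colour `c` appears between vertex 0 and vertex `suc s + toℕ c`, where the maximum exceeds
  -- `suc s` by exactly `c`.
  nestedStars-exact : Exact (nestedStars s k)
  nestedStars-exact c = 0F , suc s ↑ʳ c , (λ ()) , Fin.toℕ-injective (begin
    toℕ (color 0F (suc s ↑ʳ c) λ ())  ≡⟨ toℕ-color 0F (suc s ↑ʳ c) (λ ()) ⟩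
    toℕ (suc s ↑ʳ c) ∸ suc s          ≡⟨ cong (_∸ suc s) (Fin.toℕ-↑ʳ (suc s) c) ⟩
    suc s + toℕ c ∸ suc s             ≡⟨ ℕ.m+n∸m≡n (suc s) (toℕ c) ⟩
    toℕ c                             ∎)
    where open ≡-Reasoning

  color-to-larger : ∀ {i j l} (i≢l : i ≢ l) (j≢l : j ≢ l) → toℕ i ≤ toℕ l → toℕ j ≤ toℕ l →
                    color i l i≢l ≡ color j l j≢l
  color-to-larger {i} {j} {l} i≢l j≢l i≤l j≤l = Fin.toℕ-injective (begin
    toℕ (color i l i≢l)        ≡⟨ toℕ-color i l i≢l ⟩
    toℕ i ⊔ toℕ l ∸ suc s      ≡⟨ cong (_∸ suc s) (trans (ℕ.m≤n⇒m⊔n≡n i≤l) (sym (ℕ.m≤n⇒m⊔n≡n j≤l))) ⟩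
    toℕ j ⊔ toℕ l ∸ suc s      ≡⟨ toℕ-color j l j≢l ⟨
    toℕ (color j l j≢l)        ∎)
    where open ≡-Reasoning

  -- The largest vertex of a triangle is joined to the other two in the same colour.
  nestedStars-no-rainbow : ∀ {S} → ¬ RainbowCopy (nestedStars s k) K₃ S
  nestedStars-no-rainbow {S} (copy , rainbow) = largest
    where
    open _≅_ copy

    not-largest : ∀ i j l → Graph.Adj K₃ i l → Graph.Adj K₃ j l → i ≢ j →
                  toℕ (to i) ≤ toℕ (to l) → toℕ (to j) ≤ toℕ (to l) → ⊥
    not-largest i j l il jl i≢j i≤l j≤l
      with rainbow (subst T (sym (adj-to i l)) il) (subst T (sym (adj-to j l)) jl)
             (color-to-larger (Graph.Adj⇒≢ K₃ il ∘ injective) (Graph.Adj⇒≢ K₃ jl ∘ injective) i≤l j≤l)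
    ... | inj₁ (i≡j , _) = i≢j (injective i≡j)
    ... | inj₂ (_ , l≡j) = Graph.Adj⇒≢ K₃ jl (sym (injective l≡j))

    largest : ⊥
    largest with ℕ.≤-total (toℕ (to 0F)) (toℕ (to 1F))
               | ℕ.≤-total (toℕ (to 1F)) (toℕ (to 2F))
               | ℕ.≤-total (toℕ (to 0F)) (toℕ (to 2F))
    ... | inj₁ 0≤1 | inj₁ 1≤2 | _        = not-largest 0F 1F 2F _ _ (λ ()) (≤-trans 0≤1 1≤2) 1≤2
    ... | inj₁ 0≤1 | inj₂ 2≤1 | _        = not-largest 0F 2F 1F _ _ (λ ()) 0≤1 2≤1
    ... | inj₂ 1≤0 | _        | inj₂ 2≤0 = not-largest 1F 2F 0F _ _ (λ ()) 1≤0 2≤0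
    ... | inj₂ 1≤0 | _        | inj₁ 0≤2 = not-largest 0F 1F 2F _ _ (λ ()) 0≤2 (≤-trans 1≤0 0≤2)

  -- Disjoint edges have different maxima, so their colours agree only where the subtraction
  -- truncates, at colour 0.
  disjoint-edges-same-color : ∀ {a b c d} (a≢b : a ≢ b) (c≢d : c ≢ d) →
    a ≢ c → a ≢ d → b ≢ c → b ≢ d → color a b a≢b ≡ color c d c≢d →
    toℕ a ≤ suc s × toℕ b ≤ suc s
  disjoint-edges-same-color {a} {b} {c} {d} a≢b c≢d a≢c a≢d b≢c b≢d same =
    ℕ.m⊔n≤o⇒m≤o (toℕ a) (toℕ b) small , ℕ.m⊔n≤o⇒n≤o (toℕ a) (toℕ b) small
    where
    max-distinct : toℕ a ⊔ toℕ b ≢ toℕ c ⊔ toℕ d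
    max-distinct eq with ℕ.⊔-sel (toℕ a) (toℕ b) | ℕ.⊔-sel (toℕ c) (toℕ d)
    ... | inj₁ p | inj₁ q = a≢c (Fin.toℕ-injective (trans (sym p) (trans eq q)))
    ... | inj₁ p | inj₂ q = a≢d (Fin.toℕ-injective (trans (sym p) (trans eq q)))
    ... | inj₂ p | inj₁ q = b≢c (Fin.toℕ-injective (trans (sym p) (trans eq q)))
    ... | inj₂ p | inj₂ q = b≢d (Fin.toℕ-injective (trans (sym p) (trans eq q)))

    small : toℕ a ⊔ toℕ b ≤ suc s
    small = ∸-collision (suc s) max-distinct
      (trans (sym (toℕ-color a b a≢b)) (trans (cong toℕ same) (toℕ-color c d c≢d)))

  module _ {S : Subgraph (suc s + suc k)} (copy : MonochromaticCopy (nestedStars s k) 2K₂ S) where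
    open _≅_ (proj₁ copy)

    private
      apart : ∀ {i j} → i ≢ j → to i ≢ to j
      apart i≢j = i≢j ∘ injective

      same : color (to 0F) (to 1F) (apart λ ()) ≡ color (to 2F) (to 3F) (apart λ ())
      same = proj₂ copy (subst T (sym (adj-to 0F 1F)) _) (subst T (sym (adj-to 2F 3F)) _)

      ab-small = disjoint-edges-same-color (apart λ ()) (apart λ ())
                   (apart λ ()) (apart λ ()) (apart λ ()) (apart λ ()) same
      cd-small = disjoint-edges-same-color (apart λ ()) (apart λ ())
                   (apart λ ()) (apart λ ()) (apart λ ()) (apart λ ()) (sym same)

    monochromatic⇒small : ∀ i → toℕ (to i) ℕ.< 2 + s
    monochromatic⇒small 0F = s≤s (proj₁ ab-small)
    monochromatic⇒small 1F = s≤s (proj₂ ab-small)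
    monochromatic⇒small 2F = s≤s (proj₁ cd-small)
    monochromatic⇒small 3F = s≤s (proj₂ cd-small)

    -- The embedding factors through the clique on the first `2 + s` vertices, which is too small
    -- for `s = 1` and has exactly four vertices for `s = 2`.
    restricted : Fin 4 → Fin (2 + s)
    restricted i = fromℕ< (monochromatic⇒small i)

    restricted-injective : Injective _≡_ _≡_ restricted
    restricted-injective eq =
      injective (Fin.toℕ-injective
        (Fin.fromℕ<-injective _ _ (monochromatic⇒small _) (monochromatic⇒small _) eq))

nestedStars₁-no-monochromatic : ∀ {S} → ¬ MonochromaticCopy (nestedStars 1 k) 2K₂ S
nestedStars₁-no-monochromatic copy = contradiction (injective⇒≤ (restricted-injective copy)) (ℕ.<⇒≱ ℕ.≤-refl)

-- For `s = 2` the map `restricted` is an injection of `Fin 4` into itself, hence onto, so a copy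
-- uses all four clique vertices.
nestedStars₂-vertices : ∀ {S} → MonochromaticCopy (nestedStars 2 k) 2K₂ S →
                        ∀ v → v Subset.∈ Subgraph.vertices S ⇔ toℕ v ℕ.< 4
nestedStars₂-vertices {S = S} copy v = mk⇔ small member
  where
  open _≅_ (proj₁ copy)

  small : v Subset.∈ Subgraph.vertices S → toℕ v ℕ.< 4
  small v∈ with ⇒ (image v) v∈
  ... | i , refl = monochromatic⇒small copy i

  member : toℕ v ℕ.< 4 → v Subset.∈ Subgraph.vertices S
  member v<4 with injective⇒surjective (restricted-injective copy) (fromℕ< v<4)
  ... | i , eq = ⇐ (image v) (i , Fin.toℕ-injective
    (Fin.fromℕ<-injective _ _ (monochromatic⇒small copy i) v<4 eq))

-- The three perfect matchings of the four-vertex clique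

-- The value `2F` is returned untested, which makes the search total; it is correct once some index
-- is known to pass.
first : (Fin 3 → Bool) → Fin 3
first p = if p 0F then 0F else if p 1F then 1F else 2F

first-cong : {p q : Fin 3 → Bool} → p ≗ q → first p ≡ first q
first-cong p≗q rewrite p≗q 0F | p≗q 1F = refl

first-satisfies : (p : Fin 3 → Bool) → ∃ (T ∘ p) → T (p (first p))
first-satisfies p some with p 0F in p0 | p 1F in p1
... | true  | _     = ⇐ T-≡ p0
... | false | true  = ⇐ T-≡ p1
... | false | false with some
...   | 0F , t = contradiction (subst T p0 t) id
...   | 1F , t = contradiction (subst T p1 t) id
...   | 2F , t = t

module _ {k : ℕ} where

  private
    N₂ : ℕ
    N₂ = 3 + suc k

  -- Row `r` pairs vertex 0 with vertex `r + 1`, and the other two clique vertices with each other.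
  ends : Fin 3 → Vec (Fin N₂) 4
  ends 0F = 0F ∷ 1F ∷ 2F ∷ 3F ∷ []
  ends 1F = 0F ∷ 2F ∷ 1F ∷ 3F ∷ []
  ends 2F = 0F ∷ 3F ∷ 1F ∷ 2F ∷ []

  ends-unique : ∀ r → Vec.Unique (ends r)
  ends-unique 0F = ((λ ()) ∷ (λ ()) ∷ (λ ()) ∷ []) ∷ ((λ ()) ∷ (λ ()) ∷ []) ∷ ((λ ()) ∷ []) ∷ [] ∷ []
  ends-unique 1F = ((λ ()) ∷ (λ ()) ∷ (λ ()) ∷ []) ∷ ((λ ()) ∷ (λ ()) ∷ []) ∷ ((λ ()) ∷ []) ∷ [] ∷ []
  ends-unique 2F = ((λ ()) ∷ (λ ()) ∷ (λ ()) ∷ []) ∷ ((λ ()) ∷ (λ ()) ∷ []) ∷ ((λ ()) ∷ []) ∷ [] ∷ []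

  perfect : Fin 3 → Subgraph N₂
  perfect r = imageGraph 2K₂ (lookup-inj (ends-unique r))

  perfect-copy : ∀ r → MonochromaticCopy (nestedStars 2 k) 2K₂ (perfect r)
  perfect-copy r = imageGraph-copy 2K₂ (lookup-inj (ends-unique r)) , monochromatic r
    where
    monochromatic : ∀ r → Monochromatic (nestedStars 2 k) (perfect r)
    -- All pairs among the first four vertices have maximum at most 3, so both colours compute to 0.
    monochromatic 0F = matching-monochromatic (ends-unique 0F) (nestedStars 2 k) (λ ()) (λ ()) refl
    monochromatic 1F = matching-monochromatic (ends-unique 1F) (nestedStars 2 k) (λ ()) (λ ()) refl
    monochromatic 2F = matching-monochromatic (ends-unique 2F) (nestedStars 2 k) (λ ()) (λ ()) refl

  partner : Fin 3 → Fin N₂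
  partner r = lookup (ends r) 1F

  -- A perfect matching on four vertices is determined by the partner of vertex 0.
  classify : Subgraph N₂ → Fin 3
  classify S = first λ r → Subgraph.adj S 0F (partner r)

  classify-cong : ∀ {S S′} → Setoid._≈_ (subgraphs N₂) S S′ → classify S ≡ classify S′
  classify-cong (_ , adj≡) = first-cong λ r → adj≡ 0F (partner r)

  classify-perfect : ∀ r → classify (perfect r) ≡ r
  classify-perfect 0F = refl
  classify-perfect 1F = refl
  classify-perfect 2F = refl

  module _ {S : Subgraph N₂} (copy : MonochromaticCopy (nestedStars 2 k) 2K₂ S) where
    open Subgraph S

    -- Every copy contains vertex 0, which has a neighbour in `2K₂`; that neighbour is again a
    -- clique vertex, so it is 1, 2 or 3.
    zero-partner : ∃ λ r → Adj 0F (partner r)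
    zero-partner
      with ⇒ (_≅_.image (proj₁ copy) 0F) (⇐ (nestedStars₂-vertices copy 0F) (s≤s z≤n))
    ... | i , to-i≡0 = let j , ij = 2K₂-partner i in
      small-partner (_≅_.to (proj₁ copy) j) (monochromatic⇒small copy j)
        (subst (λ v → Adj v (_≅_.to (proj₁ copy) j)) to-i≡0
          (subst T (sym (_≅_.adj-to (proj₁ copy) i j)) ij))
      where
      small-partner : ∀ v → toℕ v ℕ.< 4 → Adj 0F v → ∃ λ r → Adj 0F (partner r)
      small-partner 0F _ 0v = contradiction refl (Adj⇒≢ 0v)
      small-partner 1F _ 0v = 0F , 0v
      small-partner 2F _ 0v = 1F , 0v
      small-partner 3F _ 0v = 2F , 0v
      small-partner (suc (suc (suc (suc _)))) (s≤s (s≤s (s≤s (s≤s ())))) _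

    classify-partner : Adj 0F (partner (classify S))
    classify-partner = first-satisfies (λ r → adj 0F (partner r)) zero-partner

    -- Both subgraphs have the first four vertices as vertex set and share the edge from 0 to its
    -- partner, so they agree.
    classify-correct : Setoid._≈_ (subgraphs N₂) (perfect (classify S)) S
    classify-correct = 2K₂-copies-sharing-edge (proj₁ (perfect-copy (classify S))) (proj₁ copy)
      (⊆-antisym
        (λ {v} → ⇐ (nestedStars₂-vertices copy v) ∘ ⇒ (perfect-vertices v))
        (λ {v} → ⇐ (perfect-vertices v) ∘ ⇒ (nestedStars₂-vertices copy v)))
      (zero∈ (classify S)) classify-partner
      where
      perfect-vertices : ∀ v → v Subset.∈ Subgraph.vertices (perfect (classify S)) ⇔ toℕ v ℕ.< 4
      perfect-vertices = nestedStars₂-vertices (perfect-copy (classify S))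

      zero∈ : ∀ r → Subgraph.Adj (perfect r) 0F (partner r)
      zero∈ 0F = imageGraph-adj⁺ 2K₂ (lookup-inj (ends-unique 0F)) {0F} {1F} _
      zero∈ 1F = imageGraph-adj⁺ 2K₂ (lookup-inj (ends-unique 1F)) {0F} {1F} _
      zero∈ 2F = imageGraph-adj⁺ 2K₂ (lookup-inj (ends-unique 2F)) {0F} {1F} _

  nestedStars₂-count : HasCount (MonochromaticCopy (nestedStars 2 k) 2K₂) 3
  nestedStars₂-count = record
    { to        = λ r → perfect r , perfect-copy r
    ; from      = λ (S , _) → classify S
    ; to-cong   = λ { {r} refl → Setoid.refl (subgraphs N₂) {perfect r} }
    ; from-cong = λ {(S , _)} {(S′ , _)} → classify-cong {S} {S′}
    ; inverse   = (λ { {S , copy} refl → classify-correct copy })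
                , λ {r} {(S , _)} S≈ → trans (classify-cong {S} {perfect r} S≈) (classify-perfect r)
    }

-- The Gallai-Ramsey number and the multiplicity

HasCount-zero : {P : Subgraph N → Set} → (∀ {S} → ¬ P S) → HasCount P 0
HasCount-zero none = record
  { to        = λ ()
  ; from      = λ (_ , p) → ⊥-elim (none p)
  ; to-cong   = λ { {()} }
  ; from-cong = λ {(_ , p)} → ⊥-elim (none p)
  ; inverse   = (λ { {_ , p} → ⊥-elim (none p) }) , λ { {()} }
  }

gallai-ramsey-number : ∀ k → IsGallaiRamseyNumber (suc k) K₃ 2K₂ (3 + suc k)
gallai-ramsey-number k = (enough-edges , λ N large χ _ → inj₂ (monochromatic-2K₂ χ large)) , least
  where
  enough-edges : suc k ≤ (4 + k) C 2
  enough-edges = begin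
    suc k                        ≤⟨ ℕ.m≤n+m (suc k) 2 ⟩
    3 + k                        ≡⟨ nC1≡n (3 + k) ⟨
    (3 + k) C 1                  ≤⟨ ℕ.m≤m+n _ _ ⟩
    (3 + k) C 1 + (3 + k) C 2    ≡⟨ nCk+nC[k+1]≡[n+1]C[k+1] (3 + k) 1 ⟩
    (4 + k) C 2                  ∎
    where open ℕ.≤-Reasoning

  least : ∀ m → suc k ≤ m C 2 × (∀ N → m ≤ N → Unavoidable (suc k) K₃ 2K₂ N) → 4 + k ≤ m
  -- A value `m` below `4 + k` would cover the complete graph on `2 + suc k` vertices, where
  -- `nestedStars 1 k` contains neither kind of copy.
  least m (_ , unavoidable) = ℕ.≮⇒≥ λ { (s≤s m≤) →
    [ nestedStars-no-rainbow ∘ proj₂ , nestedStars₁-no-monochromatic ∘ proj₂ ]′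
      (unavoidable (2 + suc k) m≤ (nestedStars 1 k) nestedStars-exact) }

theorem3p9 : (k : ℕ) → 6 ≤ k → IsGallaiRamseyMultiplicity k K₃ 2K₂ 3
theorem3p9 (suc k) _ = 3 + suc k , gallai-ramsey-number k , attained , least
  where
  attained : AttainedTotal (suc k) K₃ 2K₂ (3 + suc k) 3
  attained = nestedStars 2 k , nestedStars-exact , 0 , 3 ,
    HasCount-zero nestedStars-no-rainbow , nestedStars₂-count , refl

  least : ∀ t → AttainedTotal (suc k) K₃ 2K₂ (3 + suc k) t → 3 ≤ t
  least _ (χ , _ , a , b , _ , count , refl) =
    -- The monochromatic copies alone contribute at least three to `a + b`.
    ≤-trans (monochromatic-2K₂-count χ ℕ.≤-refl count) (ℕ.m≤n+m b a)
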